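{- For all integers $n\geq 0$, $$a_{1^{4}2^{ -2}4^{ -1}}(2n)>0,\qquad a_{1^{4}2^{ -2}4^{ -1}}(4n+1)<0,\qquad a_{1^{4}2^{ -2}4^{ -1}}(4n+3)=0.$$
   Context: For $|q|<1$ (or as formal power series in $q$) let $f_j:=(q^j;q^j)_\infty=\prod_{k\ge 1}(1-q^{jk})$ for each positive integer $j$. The integers $a_{1^{4}2^{ -2}4^{ -1}}(n)$, $n\ge 0$, are defined by $\sum_{n=0}^\infty a_{1^{4}2^{ -2}4^{ -1}}(n)q^n=\dfrac{f_1^4}{f_2^2f_4}$. -}

module Defs where

open import Data.Nat as ℕ using (ℕ; zero; suc; _∸_; NonZero)
import Data.Nat.Properties as ℕ
open import Data.Fin using (Fin; toℕ)
open import Data.Fin.Properties using (toℕ<n)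
open import Data.Integer using (ℤ; 0ℤ; 1ℤ; -_; _+_; _-_; _*_)
import Data.Integer.Properties as ℤ
open import Algebra.Properties.Semiring.Sum ℤ.+-*-semiring
open import Data.Bool using (if_then_else_)
open import Relation.Nullary.Decidable using (does; dec-false)
open import Relation.Binary.PropositionalEquality
open ≡-Reasoning

-- Formal power series in q over ℤ, as coefficient sequences;
-- two series are equal when they are pointwise equal (_≗_).
Series : Set
Series = ℕ → ℤ

infixl 6 _⊖_
infixl 7 _⊛_ _⊘_
infixr 8 _^^_

q^ : ℕ → Series
q^ m n = if does (m ℕ.≟ n) then 1ℤ else 0ℤ

_⊖_ : Series → Series → Series
(F ⊖ G) n = F n - G n

_⊛_ : Series → Series → Series
(F ⊛ G) n = ∑[ i ≤ n ] (F (toℕ i) * G (n ∸ toℕ i))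

_^^_ : Series → ℕ → Series
F ^^ zero  = q^ 0
F ^^ suc k = F ⊛ F ^^ k

-- Quotient of power series, computed by long division.  It is meaningful only
-- when the divisor has constant term 1; see ⊘-correct.
_⊘_ : Series → Series → Series
(F ⊘ G) zero    = F 0
(F ⊘ G) (suc n) = ((λ k → F (suc k) - F 0 * G (suc k)) ⊘ G) n

⊘-correct : ∀ F G → G 0 ≡ 1ℤ → (F ⊘ G) ⊛ G ≗ F
⊘-correct F G G₀ zero = begin
  F 0 * G 0 + 0ℤ ≡⟨ ℤ.+-identityʳ _ ⟩
  F 0 * G 0      ≡⟨ cong (F 0 *_) G₀ ⟩
  F 0 * 1ℤ       ≡⟨ ℤ.*-identityʳ (F 0) ⟩
  F 0            ∎
⊘-correct F G G₀ (suc n) = begin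
  x + (R ⊘ G ⊛ G) n     ≡⟨ cong (λ z → x + z) (⊘-correct R G G₀ n) ⟩
  x + (F (suc n) - x)   ≡⟨ ℤ.+-comm x _ ⟩
  F (suc n) - x + x     ≡⟨ ℤ.+-assoc (F (suc n)) _ x ⟩
  F (suc n) + (- x + x) ≡⟨ cong (F (suc n) +_) (ℤ.+-inverseˡ x) ⟩
  F (suc n) + 0ℤ        ≡⟨ ℤ.+-identityʳ _ ⟩
  F (suc n)             ∎
  where
  x = F 0 * G (suc n)
  R : Series
  R k = F (suc k) - F 0 * G (suc k)

-- partialProduct j N  =  ∏_{k=1}^{N} (1 - q^{jk})
partialProduct : ℕ → ℕ → Series
partialProduct j zero    = q^ 0
partialProduct j (suc N) = (q^ 0 ⊖ q^ (j ℕ.* suc N)) ⊛ partialProduct j N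

-- f j  =  (q^j ; q^j)_∞.  As j ≥ 1, the factors with k > n do not affect the
-- coefficient of q^n, which is therefore that of the n-th partial product;
-- see f-limit.
f : (j : ℕ) → .{{NonZero j}} → Series
f j n = partialProduct j n n

factor-trivial : ∀ {m n} F → n ℕ.< m → ((q^ 0 ⊖ q^ m) ⊛ F) n ≡ F n
factor-trivial {m} {n} F n<m = begin
  H 0 * F n + ∑[ i < n ] (H (suc (toℕ i)) * F (n ∸ suc (toℕ i)))
    ≡⟨ cong₂ _+_ (cong (_* F n) H₀) (sum-cong-≗ {n} vanish) ⟩
  1ℤ * F n + ∑[ i < n ] 0ℤ
    ≡⟨ cong₂ _+_ (ℤ.*-identityˡ (F n)) (sum-replicate-zero n) ⟩
  F n + 0ℤ
    ≡⟨ ℤ.+-identityʳ (F n) ⟩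
  F n ∎
  where
  H : Series
  H = q^ 0 ⊖ q^ m

  q^-≢ : ∀ {k} → k ℕ.< m → q^ m k ≡ 0ℤ
  q^-≢ {k} k<m = cong (λ b → if b then 1ℤ else 0ℤ)
                      (dec-false (m ℕ.≟ k) (≢-sym (ℕ.<⇒≢ k<m)))

  H₀ : H 0 ≡ 1ℤ
  H₀ = cong (λ z → 1ℤ - z) (q^-≢ (ℕ.≤-<-trans ℕ.z≤n n<m))

  vanish : (i : Fin n) → H (suc (toℕ i)) * F (n ∸ suc (toℕ i)) ≡ 0ℤ
  vanish i = trans
    (cong (λ z → (0ℤ - z) * F (n ∸ suc (toℕ i)))
          (q^-≢ (ℕ.≤-<-trans (toℕ<n i) n<m)))
    (ℤ.*-zeroˡ (F (n ∸ suc (toℕ i))))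

f-limit : ∀ j .{{_ : NonZero j}} d n → partialProduct j (d ℕ.+ n) n ≡ f j n
f-limit j zero    n = refl
f-limit j (suc d) n = trans
  (factor-trivial (partialProduct j (d ℕ.+ n))
    (ℕ.≤-trans (ℕ.s≤s (ℕ.m≤n+m n d)) (ℕ.m≤n*m (suc (d ℕ.+ n)) j)))
  (f-limit j d n)

a : Series
a = f 1 ^^ 4 ⊘ (f 2 ^^ 2 ⊛ f 4)

a-correct : a ⊛ (f 2 ^^ 2 ⊛ f 4) ≗ f 1 ^^ 4
a-correct = ⊘-correct (f 1 ^^ 4) (f 2 ^^ 2 ⊛ f 4) refl

{-# OPTIONS --safe #-}

-- By Gauss, f₁²/f₂ = θ with θ = Σ_k (-1)^k q^(k²), so the series is θ²/f₄.  The
-- coefficients of θ are ≥ 0 at exponents ≡ 0, ≤ 0 at exponents ≡ 1 and zero at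
-- exponents ≡ 2, 3 modulo 4; hence those of θ² are ≥ 0, ≤ 0, ≥ 0, = 0 at
-- exponents ≡ 0, 1, 2, 3.  Dividing by the factors 1 - q^(4k) of f₄ preserves
-- this pattern, and since θ² = 1 - 4q + 4q² + ⋯ already the division by 1 - q⁴
-- makes the inequalities strict.
--
-- Gauss's identity follows from a finite version in the manner of Shanks,
--   (q;q)_n Σ_{s≤n} (-1;q)_s/(q;q)_s (-q^(n+1))^s = (-q;q)_n Σ_{|k|≤n} (-1)^k q^(k²),
-- which holds in every commutative ring in which the ratios make sense and is
-- proved by induction on n.  Modulo q^(N+1) the sum on the left for n = N is 1.

module Submission where

open import Defs
open import Algebra.Bundles using (CommutativeRing)
import Algebra.Properties.CommutativeSemiring.Exp as Exp
import Algebra.Properties.Ring as RingProperties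
open import Algebra.Properties.Semiring.Sum using (sum; sum-cong-≗)
import Algebra.Solver.Ring.NaturalCoefficients.Default as NatSolver
open import Data.Fin using (Fin; toℕ; zero; suc)
open import Data.Fin.Properties using (toℕ<n)
open import Data.Integer as ℤ using (ℤ; 0ℤ; 1ℤ)
import Data.Integer.Properties as ℤ
open import Data.Integer.Tactic.RingSolver using (solve-∀)
open import Data.Nat as ℕ using (ℕ; zero; suc; _≤_; _∸_; z≤n; s≤s; NonZero)
open import Data.Nat.Induction using (<-rec)
import Data.Nat.Properties as ℕ
open import Data.Nat.Solver using (module +-*-Solver)
open import Data.Product using (_×_; _,_; ∃)
open import Data.Sum using (_⊎_; inj₁; inj₂)
open import Level using (0ℓ)
open import Relation.Binary.PropositionalEquality as ≡
  using (_≡_; _≗_; refl; cong; cong₂; subst; module ≡-Reasoning)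
import Relation.Binary.Reasoning.Setoid as SetoidReasoning
open import Relation.Nullary using (yes; no)

-- Finite form of Gauss's identity in a commutative ring.

module FiniteGauss {ℓ₁ ℓ₂} (R : CommutativeRing ℓ₁ ℓ₂) where

  open CommutativeRing R renaming (refl to ≈-refl)
  open Exp commutativeSemiring using (_^_; ^-distrib-*; ^-congˡ; ^-homo-*)
  open SetoidReasoning setoid
  open NatSolver commutativeSemiring using (solve; _:+_; _:*_; _:=_; con)
  open RingProperties ring using (-‿distribˡ-*; -0#≈0#)

  module Ratios
    (q : Carrier) (c : ℕ → Carrier) (c₀ : c 0 ≈ 1#)
    (c-step : ∀ s → c (suc s) * (1# - q ^ suc s) ≈ c s * (1# + q ^ s))
    where

    w : ℕ → Carrier
    w n = - (q ^ n)

    -- A n = (q;q)_n, B n = (-q;q)_n and, in view of the assumption on c,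
    -- c s = (-1;q)_s / (q;q)_s.
    A B θ : ℕ → Carrier
    A zero    = 1#
    A (suc n) = (1# + w (suc n)) * A n
    B zero    = 1#
    B (suc n) = (1# + q ^ suc n) * B n
    θ zero    = 1#
    θ (suc n) = θ n + (1# + 1#) * w (suc n) ^ suc n

    -- The terms s < m of the q-binomial series Σ_s (-1;q)_s/(q;q)_s z^s = (-z;q)_∞/(z;q)_∞. The
    -- full series satisfies (1-z)·X(z) = (1+z)·X(zq), which the truncation satisfies up to a
    -- boundary term.
    X : ℕ → Carrier → Carrier
    X zero    z = 0#
    X (suc m) z = X m z + c m * z ^ m

    w+q≈0 : ∀ n → w n + q ^ n ≈ 0#
    w+q≈0 n = -‿inverseˡ (q ^ n)

    -- The semiring solver treats `w n` and `q ^ n` as unrelated atoms. That they cancel enters only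
    -- by adding or removing a multiple of their sum, through this lemma.
    absorb : ∀ n y x → x + y * (w n + q ^ n) ≈ x
    absorb n y x = trans (+-congˡ (trans (*-congˡ (w+q≈0 n)) (zeroʳ y))) (+-identityʳ x)

    c-split : ∀ s → c s * (1# + q ^ s) + c (suc s) * q ^ suc s ≈ c (suc s)
    c-split s = begin
      c s * (1# + q ^ s) + C * Q
        ≈⟨ +-congʳ (c-step s) ⟨
      C * (1# - Q) + C * Q
        ≈⟨ solve 3 (λ x u v → x :* (con 1 :+ u) :+ x :* v := x :+ x :* (u :+ v)) ≈-refl C (w (suc s)) Q ⟩
      C + C * (w (suc s) + Q)
        ≈⟨ absorb (suc s) C C ⟩
      C ∎
      where
      C = c (suc s)
      Q = q ^ suc s

    -- Obtained by telescoping: the defining relation of c turns the difference of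
    -- the m-th terms of (1+z)·X(zq) and (1-z)·X(z) into a forward difference of
    -- c m · z ^ m · (1 - q ^ m).  All subtractions are moved across, which makes
    -- each step a semiring identity.
    X-q-difference : ∀ m z →
      (1# + z) * X m (z * q) + z * X m z + c m * z ^ m * q ^ m ≈ X m z + c m * z ^ m
    X-q-difference zero z =
      solve 2 (λ z c → (con 1 :+ z) :* con 0 :+ z :* con 0 :+ c :* con 1 :* con 1 := con 0 :+ c :* con 1)
        ≈-refl z (c 0)
    X-q-difference (suc m) z = begin
      (1# + z) * (X m (z * q) + c m * (z * q) ^ m) + z * (X m z + c m * z ^ m) + C * (z * Z) * Q′
        ≈⟨ +-congʳ (+-congʳ (*-congˡ (+-congˡ (*-congˡ (^-distrib-* z q m))))) ⟩
      (1# + z) * (X m (z * q) + c m * (Z * Q)) + z * (X m z + c m * Z) + C * (z * Z) * Q′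
        ≈⟨ solve 8 (λ z Z Q Q′ x x′ c C →
             (con 1 :+ z) :* (x′ :+ c :* (Z :* Q)) :+ z :* (x :+ c :* Z) :+ C :* (z :* Z) :* Q′
             := ((con 1 :+ z) :* x′ :+ z :* x :+ c :* Z :* Q)
                :+ (z :* Z) :* (c :* (con 1 :+ Q) :+ C :* Q′))
             ≈-refl z Z Q Q′ (X m z) (X m (z * q)) (c m) C ⟩
      ((1# + z) * X m (z * q) + z * X m z + c m * Z * Q) + (z * Z) * (c m * (1# + Q) + C * Q′)
        ≈⟨ +-cong (X-q-difference m z) (*-congˡ (c-split m)) ⟩
      (X m z + c m * Z) + (z * Z) * C
        ≈⟨ +-congˡ (*-comm (z * Z) C) ⟩
      (X m z + c m * Z) + C * (z * Z) ∎
      where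
      C = c (suc m)
      Z = z ^ m
      Q = q ^ m
      Q′ = q ^ suc m

    -- In terms of ratios both sides are (-1;q)_(n+1). Without division: the last factor of
    -- `A (suc n)` clears the denominator of `c (suc n)`, and what remains is the previous instance
    -- times `1# + q ^ n`.
    A*c : ∀ n → A (suc n) * c (suc n) ≈ (1# + 1#) * B n
    A*c n = begin
      (1# + w (suc n)) * A n * c (suc n)
        ≈⟨ solve 3 (λ u a c → u :* a :* c := a :* (c :* u)) ≈-refl _ (A n) (c (suc n)) ⟩
      A n * (c (suc n) * (1# + w (suc n)))
        ≈⟨ *-congˡ (c-step n) ⟩
      A n * (c n * (1# + q ^ n))
        ≈⟨ *-assoc _ _ _ ⟨
      A n * c n * (1# + q ^ n)
        ≈⟨ last n ⟩
      (1# + 1#) * B n ∎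
      where
      last : ∀ n → A n * c n * (1# + q ^ n) ≈ (1# + 1#) * B n
      last zero    = begin
        1# * c 0 * (1# + 1#)  ≈⟨ *-congʳ (*-congˡ c₀) ⟩
        1# * 1# * (1# + 1#)   ≈⟨ solve 0 (con 1 :* con 1 :* con 2 := con 2 :* con 1) ≈-refl ⟩
        (1# + 1#) * 1#        ∎
      last (suc n) = begin
        A (suc n) * c (suc n) * (1# + q ^ suc n)  ≈⟨ *-congʳ (A*c n) ⟩
        (1# + 1#) * B n * (1# + q ^ suc n)
          ≈⟨ solve 2 (λ b u → con 2 :* b :* u := con 2 :* (u :* b)) ≈-refl (B n) (1# + q ^ suc n) ⟩
        (1# + 1#) * B (suc n)                     ∎

    w-suc : ∀ n → w (suc n) ≈ w n * q
    w-suc n = trans (-‿cong (*-comm q (q ^ n))) (-‿distribˡ-* (q ^ n) q)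

    X-cong : ∀ m {y z} → y ≈ z → X m y ≈ X m z
    X-cong zero    y≈z = ≈-refl
    X-cong (suc m) y≈z = +-cong (X-cong m y≈z) (*-congˡ (^-congˡ m y≈z))

    -- The finite identity in the manner of Shanks. At z = u = `w (suc n)` one has zq =
    -- `w (suc (suc n))`, so the q-difference equation leads from n to n + 1: its factor 1 + z is
    -- the new factor of `A`, its factor 1 - z that of `B`, and by `A*c` the boundary term becomes
    -- the new term of `θ`.
    A*X≈B*θ : ∀ n → A n * X (suc n) (w (suc n)) ≈ B n * θ n
    A*X≈B*θ zero = *-congˡ (trans (+-identityˡ _) (trans (*-identityʳ (c 0)) c₀))
    A*X≈B*θ (suc n) = begin
      (1# + u) * Aₙ * X (suc (suc n)) (w (suc (suc n)))
        ≈⟨ *-congˡ (X-cong (suc (suc n)) (w-suc (suc n))) ⟩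
      (1# + u) * Aₙ * (x′ + C * (u * q) ^ suc n)
        ≈⟨ *-congˡ (+-congˡ (*-congˡ (^-distrib-* u q (suc n)))) ⟩
      (1# + u) * Aₙ * (x′ + C * (U * Q))
        -- This multiple of zero supplies the `u * x` required by the q-difference equation and the
        -- terms that later make `1# + Q` a common factor, so that both solver calls are free of
        -- subtraction.
        ≈⟨ absorb (suc n) (Aₙ * x + Aₙ * C * U) _ ⟨
      (1# + u) * Aₙ * (x′ + C * (U * Q)) + (Aₙ * x + Aₙ * C * U) * (u + Q)
        ≈⟨ solve 7 (λ u U Q a x x′ C →
             (con 1 :+ u) :* a :* (x′ :+ C :* (U :* Q)) :+ (a :* x :+ a :* C :* U) :* (u :+ Q)
             := a :* ((con 1 :+ u) :* x′ :+ u :* x :+ C :* U :* Q)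
                :+ (a :* Q :* x :+ a :* u :* C :* U :* Q :+ a :* C :* U :* (u :+ Q)))
             ≈-refl u U Q Aₙ x x′ C ⟩
      Aₙ * ((1# + u) * x′ + u * x + C * U * Q) + (Aₙ * Q * x + Aₙ * u * C * U * Q + Aₙ * C * U * (u + Q))
        ≈⟨ +-congʳ (*-congˡ (X-q-difference (suc n) u)) ⟩
      Aₙ * (x + C * U) + (Aₙ * Q * x + Aₙ * u * C * U * Q + Aₙ * C * U * (u + Q))
        ≈⟨ solve 6 (λ u U Q a x C →
             a :* (x :+ C :* U) :+ (a :* Q :* x :+ a :* u :* C :* U :* Q :+ a :* C :* U :* (u :+ Q))
             := (con 1 :+ Q) :* (a :* x :+ (con 1 :+ u) :* a :* C :* U))
             ≈-refl u U Q Aₙ x C ⟩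
      (1# + Q) * (Aₙ * x + A (suc n) * C * U)
        ≈⟨ *-congˡ (+-cong (A*X≈B*θ n) (*-congʳ (A*c n))) ⟩
      (1# + Q) * (B n * θ n + (1# + 1#) * B n * U)
        ≈⟨ solve 4 (λ v b t U → v :* (b :* t :+ con 2 :* b :* U) := v :* b :* (t :+ con 2 :* U))
             ≈-refl (1# + Q) (B n) (θ n) U ⟩
      (1# + Q) * B n * (θ n + (1# + 1#) * U) ∎
      where
      u = w (suc n)
      U = u ^ suc n
      Q = q ^ suc n
      Aₙ = A n
      x = X (suc n) u
      x′ = X (suc n) (u * q)
      C = c (suc n)

    X-0 : ∀ m {z} → z ≈ 0# → X (suc m) z ≈ 1#
    X-0 zero    z≈0 = trans (+-identityˡ _) (trans (*-identityʳ (c 0)) c₀)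
    X-0 (suc m) {z} z≈0 = begin
      X (suc m) z + c (suc m) * (z * z ^ m)  ≈⟨ +-cong (X-0 m z≈0) (*-congˡ (trans (*-congʳ z≈0) (zeroˡ (z ^ m)))) ⟩
      1# + c (suc m) * 0#                    ≈⟨ +-congˡ (zeroʳ (c (suc m))) ⟩
      1# + 0#                                ≈⟨ +-identityʳ 1# ⟩
      1#                                     ∎

    P : ℕ → ℕ → Carrier
    P j zero    = 1#
    P j (suc n) = (1# - q ^ (j ℕ.* suc n)) * P j n

    P₁≈A : ∀ n → P 1 n ≈ A n
    P₁≈A zero    = ≈-refl
    P₁≈A (suc n) = *-cong (+-congˡ (-‿cong (reflexive (cong (q ^_) (ℕ.*-identityˡ (suc n)))))) (P₁≈A n)

    P₂≈A*B : ∀ n → P 2 n ≈ A n * B n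
    P₂≈A*B zero    = sym (*-identityˡ 1#)
    P₂≈A*B (suc n) = begin
      (1# - q ^ (2 ℕ.* suc n)) * P 2 n
        ≈⟨ *-cong (+-congˡ (-‿cong q^2n)) (P₂≈A*B n) ⟩
      (1# - Q * Q) * (A n * B n)
        ≈⟨ *-congʳ (+-congˡ (-‿distribˡ-* Q Q)) ⟩
      (1# + u * Q) * (A n * B n)
        ≈⟨ *-congʳ (trans (+-congˡ (w+q≈0 (suc n))) (+-identityʳ (1# + u * Q))) ⟨
      (1# + u * Q + (u + Q)) * (A n * B n)
        ≈⟨ solve 4 (λ u Q a b → (con 1 :+ u :* Q :+ (u :+ Q)) :* (a :* b)
             := ((con 1 :+ u) :* a) :* ((con 1 :+ Q) :* b)) ≈-refl u Q (A n) (B n) ⟩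
      A (suc n) * B (suc n) ∎
      where
      Q = q ^ suc n
      u = w (suc n)

      q^2n : q ^ (2 ℕ.* suc n) ≈ Q * Q
      q^2n = trans (reflexive (cong (λ k → q ^ (suc n ℕ.+ k)) (ℕ.+-identityʳ (suc n))))
                   (^-homo-* q (suc n) (suc n))

    -- If `q ^ suc N` vanishes, then so does `w (suc N)`, and `X` at this point reduces to its
    -- constant term 1. The finite identity becomes `A N ≈ B N * θ N`, to be multiplied by `A N`.
    gauss : ∀ N → q ^ suc N ≈ 0# → P 1 N * P 1 N ≈ P 2 N * θ N
    gauss N q^N≈0 = begin
      P 1 N * P 1 N      ≈⟨ *-cong (P₁≈A N) (P₁≈A N) ⟩
      A N * A N          ≈⟨ *-congˡ A≈B*θ ⟩
      A N * (B N * θ N)  ≈⟨ *-assoc _ _ _ ⟨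
      A N * B N * θ N    ≈⟨ *-congʳ (P₂≈A*B N) ⟨
      P 2 N * θ N        ∎
      where
      A≈B*θ : A N ≈ B N * θ N
      A≈B*θ = begin
        A N                              ≈⟨ *-identityʳ (A N) ⟨
        A N * 1#                         ≈⟨ *-congˡ (X-0 N (trans (-‿cong q^N≈0) -0#≈0#)) ⟨
        A N * X (suc N) (w (suc N))      ≈⟨ A*X≈B*θ N ⟩
        B N * θ N                        ∎

-- Power series as a commutative ring, truncated at a given order.

module PowerSeries where

  open import Data.Integer using (_+_; _*_; -_; _-_)
  open import Data.Nat using (_<_)
  open ≡-Reasoning

  infixl 6 _⊕_

  _⊕_ : Series → Series → Series
  (F ⊕ G) n = F n + G n

  ⊝_ : Series → Series
  (⊝ F) n = - F n

  𝟘 : Series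
  𝟘 n = 0ℤ

  tail : Series → Series
  tail F n = F (suc n)

  ⊛-cong-≤ : ∀ {F F′ G G′} n → (∀ k → k ≤ n → F k ≡ F′ k) → (∀ k → k ≤ n → G k ≡ G′ k) →
             (F ⊛ G) n ≡ (F′ ⊛ G′) n
  ⊛-cong-≤ n F≈ G≈ = sum-cong-≗ ℤ.+-*-semiring λ i →
    cong₂ _*_ (F≈ _ (ℕ.≤-pred (toℕ<n i))) (G≈ _ (ℕ.m∸n≤m n (toℕ i)))

  ⊛-zeroˡ : ∀ F → 𝟘 ⊛ F ≗ 𝟘
  ⊛-zeroˡ F zero    = refl
  ⊛-zeroˡ F (suc n) = cong (0ℤ +_) (⊛-zeroˡ F n)

  ⊛-distribʳ-⊕ : ∀ F G H → (G ⊕ H) ⊛ F ≗ G ⊛ F ⊕ H ⊛ F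
  ⊛-distribʳ-⊕ F G H zero = lemma (F 0) (G 0) (H 0)
    where
    lemma : ∀ f g h → (g + h) * f + 0ℤ ≡ (g * f + 0ℤ) + (h * f + 0ℤ)
    lemma = solve-∀
  ⊛-distribʳ-⊕ F G H (suc n) = begin
    (G 0 + H 0) * F (suc n) + ((tail G ⊕ tail H) ⊛ F) n
      ≡⟨ cong ((G 0 + H 0) * F (suc n) +_) (⊛-distribʳ-⊕ F (tail G) (tail H) n) ⟩
    (G 0 + H 0) * F (suc n) + ((tail G ⊛ F) n + (tail H ⊛ F) n)
      ≡⟨ lemma (F (suc n)) (G 0) (H 0) _ _ ⟩
    (G ⊛ F ⊕ H ⊛ F) (suc n) ∎
    where
    lemma : ∀ f g h x y → (g + h) * f + (x + y) ≡ (g * f + x) + (h * f + y)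
    lemma = solve-∀

  ⊛-scale : ∀ x F G n → ((λ k → x * F k) ⊛ G) n ≡ x * (F ⊛ G) n
  ⊛-scale x F G zero = lemma x (F 0) (G 0)
    where
    lemma : ∀ x f g → x * f * g + 0ℤ ≡ x * (f * g + 0ℤ)
    lemma = solve-∀
  ⊛-scale x F G (suc n) = begin
    x * F 0 * G (suc n) + ((λ k → x * tail F k) ⊛ G) n
      ≡⟨ cong (x * F 0 * G (suc n) +_) (⊛-scale x (tail F) G n) ⟩
    x * F 0 * G (suc n) + x * (tail F ⊛ G) n
      ≡⟨ lemma x (F 0) (G (suc n)) _ ⟩
    x * (F ⊛ G) (suc n) ∎
    where
    lemma : ∀ x f g y → x * f * g + x * y ≡ x * (f * g + y)
    lemma = solve-∀

  -- The tail of `F ⊛ G` is by computation `F 0` times `tail G` plus `tail F ⊛ G`; distributivity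
  -- and scaling then reduce the claim to `tail F`.
  ⊛-assoc : ∀ F G H → (F ⊛ G) ⊛ H ≗ F ⊛ (G ⊛ H)
  ⊛-assoc F G H zero = lemma (F 0) (G 0) (H 0)
    where
    lemma : ∀ f g h → (f * g + 0ℤ) * h + 0ℤ ≡ f * (g * h + 0ℤ) + 0ℤ
    lemma = solve-∀
  ⊛-assoc F G H (suc n) = begin
    (F 0 * G 0 + 0ℤ) * H (suc n) + (((λ k → F 0 * tail G k) ⊕ tail F ⊛ G) ⊛ H) n
      ≡⟨ cong ((F 0 * G 0 + 0ℤ) * H (suc n) +_) (begin
           (((λ k → F 0 * tail G k) ⊕ tail F ⊛ G) ⊛ H) n
             ≡⟨ ⊛-distribʳ-⊕ H (λ k → F 0 * tail G k) (tail F ⊛ G) n ⟩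
           ((λ k → F 0 * tail G k) ⊛ H) n + (tail F ⊛ G ⊛ H) n
             ≡⟨ cong₂ _+_ (⊛-scale (F 0) (tail G) H n) (⊛-assoc (tail F) G H n) ⟩
           F 0 * (tail G ⊛ H) n + (tail F ⊛ (G ⊛ H)) n ∎) ⟩
    (F 0 * G 0 + 0ℤ) * H (suc n) + (F 0 * (tail G ⊛ H) n + (tail F ⊛ (G ⊛ H)) n)
      ≡⟨ lemma (F 0) (G 0) (H (suc n)) _ _ ⟩
    (F ⊛ (G ⊛ H)) (suc n) ∎
    where
    lemma : ∀ f g h x y → (f * g + 0ℤ) * h + (f * x + y) ≡ f * (g * h + x) + y
    lemma = solve-∀

  -- The convolution computes by splitting off its first summand; splitting off the last one instead
  -- is what commutativity needs.
  ⊛-suc : ∀ F G n → (F ⊛ G) (suc n) ≡ (F ⊛ tail G) n + F (suc n) * G 0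
  ⊛-suc F G zero    = lemma (F 0 * G 1) (F 1 * G 0)
    where
    lemma : ∀ x y → x + (y + 0ℤ) ≡ x + 0ℤ + y
    lemma = solve-∀
  ⊛-suc F G (suc n) = begin
    F 0 * G (suc (suc n)) + (tail F ⊛ G) (suc n)
      ≡⟨ cong (F 0 * G (suc (suc n)) +_) (⊛-suc (tail F) G n) ⟩
    F 0 * G (suc (suc n)) + ((tail F ⊛ tail G) n + F (suc (suc n)) * G 0)
      ≡⟨ ℤ.+-assoc (F 0 * G (suc (suc n))) _ _ ⟨
    (F ⊛ tail G) (suc n) + F (suc (suc n)) * G 0 ∎

  ⊛-comm : ∀ F G → F ⊛ G ≗ G ⊛ F
  ⊛-comm F G zero    = cong (_+ 0ℤ) (ℤ.*-comm (F 0) (G 0))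
  ⊛-comm F G (suc n) = begin
    F 0 * G (suc n) + (tail F ⊛ G) n
      ≡⟨ cong₂ _+_ (ℤ.*-comm (F 0) (G (suc n))) (⊛-comm (tail F) G n) ⟩
    G (suc n) * F 0 + (G ⊛ tail F) n
      ≡⟨ ℤ.+-comm (G (suc n) * F 0) _ ⟩
    (G ⊛ tail F) n + G (suc n) * F 0
      ≡⟨ ⊛-suc G F n ⟨
    (G ⊛ F) (suc n) ∎

  q^⊛-< : ∀ {m n} F → n < m → (q^ m ⊛ F) n ≡ 0ℤ
  q^⊛-< {suc m} {zero}  F _         = refl
  q^⊛-< {suc m} {suc n} F (s≤s n<m) = ≡.trans (ℤ.+-identityˡ _) (q^⊛-< F n<m)

  q^⊛-+ : ∀ m F n → (q^ m ⊛ F) (m ℕ.+ n) ≡ F n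
  q^⊛-+ zero    F zero    = lemma (F 0)
    where
    lemma : ∀ x → 1ℤ * x + 0ℤ ≡ x
    lemma = solve-∀
  q^⊛-+ zero    F (suc n) = ≡.trans (cong (1ℤ * F (suc n) +_) (⊛-zeroˡ F n)) (lemma (F (suc n)))
    where
    lemma : ∀ x → 1ℤ * x + 0ℤ ≡ x
    lemma = solve-∀
  q^⊛-+ (suc m) F n = ≡.trans (ℤ.+-identityˡ _) (q^⊛-+ m F n)

  q^-+ : ∀ m n → q^ (m ℕ.+ n) ≗ q^ m ⊛ q^ n
  q^-+ zero    n k       = ≡.sym (q^⊛-+ 0 (q^ n) k)
  q^-+ (suc m) n zero    = refl
  q^-+ (suc m) n (suc k) = ≡.trans (q^-+ m n k) (≡.sym (ℤ.+-identityˡ _))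

  -- ℤ⟦q⟧ modulo q^(N+1).
  truncatedRing : ℕ → CommutativeRing 0ℓ 0ℓ
  truncatedRing N = record
    { Carrier = Series
    ; _≈_ = λ F G → ∀ k → k ≤ N → F k ≡ G k
    ; _+_ = _⊕_
    ; _*_ = _⊛_
    ; -_ = ⊝_
    ; 0# = 𝟘
    ; 1# = q^ 0
    ; isCommutativeRing = record
      { isRing = record
        { +-isAbelianGroup = record
          { isGroup = record
            { isMonoid = record
              { isSemigroup = record
                { isMagma = record
                  { isEquivalence = record
                    { refl  = λ _ _ → refl
                    ; sym   = λ F≈G k k≤N → ≡.sym (F≈G k k≤N)
                    ; trans = λ F≈G G≈H k k≤N → ≡.trans (F≈G k k≤N) (G≈H k k≤N)
                    }
                  ; ∙-cong = λ F≈F′ G≈G′ k k≤N → cong₂ _+_ (F≈F′ k k≤N) (G≈G′ k k≤N)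
                  }
                ; assoc = λ F G H k _ → ℤ.+-assoc (F k) (G k) (H k)
                }
              ; identity = (λ F k _ → ℤ.+-identityˡ (F k)) , (λ F k _ → ℤ.+-identityʳ (F k))
              }
            ; inverse = (λ F k _ → ℤ.+-inverseˡ (F k)) , (λ F k _ → ℤ.+-inverseʳ (F k))
            ; ⁻¹-cong = λ F≈G k k≤N → cong -_ (F≈G k k≤N)
            }
          ; comm = λ F G k _ → ℤ.+-comm (F k) (G k)
          }
        ; *-cong = λ F≈F′ G≈G′ k k≤N → ⊛-cong-≤ k
            (λ i i≤k → F≈F′ i (ℕ.≤-trans i≤k k≤N)) (λ i i≤k → G≈G′ i (ℕ.≤-trans i≤k k≤N))
        ; *-assoc = λ F G H k _ → ⊛-assoc F G H k
        ; *-identity = (λ F k _ → q^⊛-+ 0 F k) , (λ F k _ → ≡.trans (⊛-comm F (q^ 0) k) (q^⊛-+ 0 F k))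
        ; distrib = (λ F G H k _ → begin
                      (F ⊛ (G ⊕ H)) k      ≡⟨ ⊛-comm F (G ⊕ H) k ⟩
                      ((G ⊕ H) ⊛ F) k      ≡⟨ ⊛-distribʳ-⊕ F G H k ⟩
                      (G ⊛ F ⊕ H ⊛ F) k    ≡⟨ cong₂ _+_ (⊛-comm G F k) (⊛-comm H F k) ⟩
                      (F ⊛ G ⊕ F ⊛ H) k    ∎)
                  , (λ F G H k _ → ⊛-distribʳ-⊕ F G H k)
        }
      ; *-comm = λ F G k _ → ⊛-comm F G k
      }
    }

open PowerSeries

-- Sign patterns modulo 4 under sums, products and division.

module SignPatterns where

  open import Data.Integer using (_+_; _*_; -_; _-_)
  open import Data.Nat using (_<_)

  -- A square is 0 or 1 modulo 4, and its parity decides the sign in θ.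
  θSign : ℕ → ℤ → Set
  θSign 0 x = 0ℤ ℤ.≤ x
  θSign 1 x = x ℤ.≤ 0ℤ
  θSign 2 x = x ≡ 0ℤ
  θSign 3 x = x ≡ 0ℤ
  θSign (suc (suc (suc (suc n)))) x = θSign n x

  -- The pattern of θ²: exponents in the support of θ are 0 or 1 modulo 4, so residue 2 arises only
  -- as 1 + 1, from two nonpositive coefficients, and residue 3 does not arise.
  WeakSign : ℕ → ℤ → Set
  WeakSign 0 x = 0ℤ ℤ.≤ x
  WeakSign 1 x = x ℤ.≤ 0ℤ
  WeakSign 2 x = 0ℤ ℤ.≤ x
  WeakSign 3 x = x ≡ 0ℤ
  WeakSign (suc (suc (suc (suc n)))) x = WeakSign n x

  StrictSign : ℕ → ℤ → Set
  StrictSign 0 x = 0ℤ ℤ.< x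
  StrictSign 1 x = x ℤ.< 0ℤ
  StrictSign 2 x = 0ℤ ℤ.< x
  StrictSign 3 x = x ≡ 0ℤ
  StrictSign (suc (suc (suc (suc n)))) x = StrictSign n x

  θSign-0 : ∀ n → θSign n 0ℤ
  θSign-0 0 = ℤ.≤-refl
  θSign-0 1 = ℤ.≤-refl
  θSign-0 2 = refl
  θSign-0 3 = refl
  θSign-0 (suc (suc (suc (suc n)))) = θSign-0 n

  θSign-+ : ∀ n {x y} → θSign n x → θSign n y → θSign n (x + y)
  θSign-+ 0 = ℤ.+-mono-≤
  θSign-+ 1 = ℤ.+-mono-≤
  θSign-+ 2 = cong₂ _+_
  θSign-+ 3 = cong₂ _+_
  θSign-+ (suc (suc (suc (suc n)))) = θSign-+ n

  WeakSign-0 : ∀ n → WeakSign n 0ℤ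
  WeakSign-0 0 = ℤ.≤-refl
  WeakSign-0 1 = ℤ.≤-refl
  WeakSign-0 2 = ℤ.≤-refl
  WeakSign-0 3 = refl
  WeakSign-0 (suc (suc (suc (suc n)))) = WeakSign-0 n

  WeakSign-+ : ∀ n {x y} → WeakSign n x → WeakSign n y → WeakSign n (x + y)
  WeakSign-+ 0 = ℤ.+-mono-≤
  WeakSign-+ 1 = ℤ.+-mono-≤
  WeakSign-+ 2 = ℤ.+-mono-≤
  WeakSign-+ 3 = cong₂ _+_
  WeakSign-+ (suc (suc (suc (suc n)))) = WeakSign-+ n

  StrictSign⇒WeakSign : ∀ n {x} → StrictSign n x → WeakSign n x
  StrictSign⇒WeakSign 0 = ℤ.<⇒≤
  StrictSign⇒WeakSign 1 = ℤ.<⇒≤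
  StrictSign⇒WeakSign 2 = ℤ.<⇒≤
  StrictSign⇒WeakSign 3 x≡0 = x≡0
  StrictSign⇒WeakSign (suc (suc (suc (suc n)))) = StrictSign⇒WeakSign n

  WeakSign-StrictSign-+ : ∀ n {x y} → WeakSign n x → StrictSign n y → StrictSign n (x + y)
  WeakSign-StrictSign-+ 0 = ℤ.+-mono-≤-<
  WeakSign-StrictSign-+ 1 = ℤ.+-mono-≤-<
  WeakSign-StrictSign-+ 2 = ℤ.+-mono-≤-<
  WeakSign-StrictSign-+ 3 = cong₂ _+_
  WeakSign-StrictSign-+ (suc (suc (suc (suc n)))) = WeakSign-StrictSign-+ n

  -- The multiple of 4 is written `t ℕ.* 4` because `suc t ℕ.* 4` computes to four successors, which
  -- the patterns strip off.
  StrictSign-mod4 : ∀ t n {x} → StrictSign (t ℕ.* 4 ℕ.+ n) x ≡ StrictSign n x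
  StrictSign-mod4 zero    n = refl
  StrictSign-mod4 (suc t) n = StrictSign-mod4 t n

  *-nonNeg-nonNeg : ∀ {x y} → 0ℤ ℤ.≤ x → 0ℤ ℤ.≤ y → 0ℤ ℤ.≤ x * y
  *-nonNeg-nonNeg {x} {y} 0≤x 0≤y =
    subst (ℤ._≤ x * y) (ℤ.*-zeroʳ x) (ℤ.*-monoˡ-≤-nonNeg x {{ℤ.nonNegative 0≤x}} 0≤y)

  *-nonNeg-nonPos : ∀ {x y} → 0ℤ ℤ.≤ x → y ℤ.≤ 0ℤ → x * y ℤ.≤ 0ℤ
  *-nonNeg-nonPos {x} {y} 0≤x y≤0 =
    subst (x * y ℤ.≤_) (ℤ.*-zeroʳ x) (ℤ.*-monoˡ-≤-nonNeg x {{ℤ.nonNegative 0≤x}} y≤0)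

  *-nonPos-nonPos : ∀ {x y} → x ℤ.≤ 0ℤ → y ℤ.≤ 0ℤ → 0ℤ ℤ.≤ x * y
  *-nonPos-nonPos {x} {y} x≤0 y≤0 =
    subst (ℤ._≤ x * y) (ℤ.*-zeroʳ x) (ℤ.*-monoˡ-≤-nonPos x {{ℤ.nonPositive x≤0}} y≤0)

  θSign-* : ∀ m n {x y} → θSign m x → θSign n y → WeakSign (m ℕ.+ n) (x * y)
  θSign-* 0 0 = *-nonNeg-nonNeg
  θSign-* 0 1 = *-nonNeg-nonPos
  θSign-* 1 0 {x} {y} x≤0 0≤y = subst (ℤ._≤ 0ℤ) (ℤ.*-comm y x) (*-nonNeg-nonPos 0≤y x≤0)
  θSign-* 1 1 = *-nonPos-nonPos
  θSign-* 2 n {y = y} refl _ = WeakSign-0 (2 ℕ.+ n)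
  θSign-* 3 n {y = y} refl _ = WeakSign-0 (3 ℕ.+ n)
  θSign-* 0 2 {x} _ refl = subst (WeakSign 2) (≡.sym (ℤ.*-zeroʳ x)) ℤ.≤-refl
  θSign-* 0 3 {x} _ refl = ℤ.*-zeroʳ x
  θSign-* 1 2 {x} _ refl = ℤ.*-zeroʳ x
  θSign-* 1 3 {x} _ refl = subst (WeakSign 4) (≡.sym (ℤ.*-zeroʳ x)) ℤ.≤-refl
  θSign-* 0 (suc (suc (suc (suc n)))) = θSign-* 0 n
  θSign-* 1 (suc (suc (suc (suc n)))) = θSign-* 1 n
  θSign-* (suc (suc (suc (suc m)))) n = θSign-* m n

  sum-closed : ∀ (P : ℤ → Set) → P 0ℤ → (∀ {x y} → P x → P y → P (x + y)) →
               ∀ {n} (t : Fin n → ℤ) → (∀ i → P (t i)) → P (sum ℤ.+-*-semiring t)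
  sum-closed P P0 P+ {zero}  t Pt = P0
  sum-closed P P0 P+ {suc n} t Pt = P+ (Pt zero) (sum-closed P P0 P+ (λ i → t (suc i)) (λ i → Pt (suc i)))

  ⊛-WeakSign : ∀ {F G} n → (∀ k → k ≤ n → θSign k (F k)) → (∀ k → k ≤ n → θSign k (G k)) →
               WeakSign n ((F ⊛ G) n)
  ⊛-WeakSign {F} {G} n SF SG = sum-closed (WeakSign n) (WeakSign-0 n) (WeakSign-+ n)
    (λ i → F (toℕ i) * G (n ∸ toℕ i)) λ i →
    let i≤n = ℕ.≤-pred (toℕ<n i) in
    subst (λ k → WeakSign k (F (toℕ i) * G (n ∸ toℕ i))) (ℕ.m+[n∸m]≡n i≤n)
      (θSign-* (toℕ i) (n ∸ toℕ i) (SF _ i≤n) (SG _ (ℕ.m∸n≤m n (toℕ i))))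

  q^[4t]-θSign : ∀ t n → θSign n (q^ (t ℕ.* 4) n)
  q^[4t]-θSign zero    zero    = ℤ.+≤+ z≤n
  q^[4t]-θSign zero    (suc n) = θSign-0 (suc n)
  q^[4t]-θSign (suc t) 0 = θSign-0 0
  q^[4t]-θSign (suc t) 1 = θSign-0 1
  q^[4t]-θSign (suc t) 2 = θSign-0 2
  q^[4t]-θSign (suc t) 3 = θSign-0 3
  q^[4t]-θSign (suc t) (suc (suc (suc (suc n)))) = q^[4t]-θSign t n

  -q^[1+4t]-θSign : ∀ t n → θSign n (- q^ (1 ℕ.+ t ℕ.* 4) n)
  -q^[1+4t]-θSign t       0 = θSign-0 0
  -q^[1+4t]-θSign zero    1 = ℤ.-≤+
  -q^[1+4t]-θSign zero    (suc (suc n)) = θSign-0 (suc (suc n))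
  -q^[1+4t]-θSign (suc t) 1 = θSign-0 1
  -q^[1+4t]-θSign (suc t) 2 = θSign-0 2
  -q^[1+4t]-θSign (suc t) 3 = θSign-0 3
  -q^[1+4t]-θSign (suc t) (suc (suc (suc (suc n)))) = -q^[1+4t]-θSign t n

  factor-shift : ∀ m G n → ((q^ 0 ⊖ q^ m) ⊛ G) (m ℕ.+ n) ≡ G (m ℕ.+ n) - G n
  factor-shift m G n = begin
    ((q^ 0 ⊖ q^ m) ⊛ G) (m ℕ.+ n)
      ≡⟨ ⊛-distribʳ-⊕ G (q^ 0) (⊝ q^ m) (m ℕ.+ n) ⟩
    (q^ 0 ⊛ G) (m ℕ.+ n) + (⊝ q^ m ⊛ G) (m ℕ.+ n)
      ≡⟨ cong₂ _+_ (q^⊛-+ 0 G (m ℕ.+ n)) (neg (m ℕ.+ n)) ⟩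
    G (m ℕ.+ n) - (q^ m ⊛ G) (m ℕ.+ n)
      ≡⟨ cong (λ x → G (m ℕ.+ n) - x) (q^⊛-+ m G n) ⟩
    G (m ℕ.+ n) - G n ∎
    where
    open ≡-Reasoning
    neg : ∀ k → (⊝ q^ m ⊛ G) k ≡ - (q^ m ⊛ G) k
    -- Modulo q^(k+1) the ring law still determines coefficient k.
    neg k = ≡.sym (-‿distribˡ-* (q^ m) G k ℕ.≤-refl)
      where open RingProperties (CommutativeRing.ring (truncatedRing k)) using (-‿distribˡ-*)

  -- As 4 divides the exponent m of the factor, the quotient G, which satisfies
  -- G (m + n) = F (m + n) + G n, inherits the sign pattern of F.
  ⊘-factor-StrictSign : ∀ {N} t F →
    (∀ n → n < suc t ℕ.* 4 → n ≤ N → StrictSign n (F n)) → (∀ n → n ≤ N → WeakSign n (F n)) →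
    ∀ n → n ≤ N → StrictSign n ((F ⊘ (q^ 0 ⊖ q^ (suc t ℕ.* 4))) n)
  ⊘-factor-StrictSign {N} t F low weak = <-rec _ step
    where
    m = suc t ℕ.* 4
    D = q^ 0 ⊖ q^ m
    G = F ⊘ D

    product : ∀ n → (D ⊛ G) n ≡ F n
    product n = ≡.trans (⊛-comm D G n) (⊘-correct F D refl n)

    recurrence : ∀ n → F (m ℕ.+ n) + G n ≡ G (m ℕ.+ n)
    recurrence n = ≡.trans
      (cong (_+ G n) (≡.trans (≡.sym (product (m ℕ.+ n))) (factor-shift m G n)))
      (cancel (G (m ℕ.+ n)) (G n))
      where
      cancel : ∀ x y → x - y + y ≡ x
      cancel = solve-∀

    step : ∀ n → (∀ {k} → k < n → k ≤ N → StrictSign k (G k)) → n ≤ N → StrictSign n (G n)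
    step n rec n≤N with n ℕ.<? m
    -- The factor does not affect coefficients below `m`, so `G n` equals `F n` and strictness comes
    -- from `low`.
    ... | yes n<m = subst (StrictSign n) (≡.trans (≡.sym (product n)) (factor-trivial G n<m)) (low n n<m n≤N)
    ... | no n≮m with n ∸ m | ℕ.m+[n∸m]≡n (ℕ.≮⇒≥ n≮m)
    ... | k | refl = subst (StrictSign (m ℕ.+ k)) (recurrence k)
      (WeakSign-StrictSign-+ (m ℕ.+ k) (weak _ n≤N)
        (subst (λ S → S) (≡.sym (StrictSign-mod4 (suc t) k))
          (rec (s≤s (ℕ.m≤n+m k (3 ℕ.+ t ℕ.* 4))) (ℕ.≤-trans (ℕ.m≤n+m k m) n≤N))))

open SignPatterns

open import Data.Nat using (ℕ; _+_; _*_)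
open import Data.Integer using (0ℤ; _<_; _>_)

-- Cancelling the divisor.

module _ {ℓ₁ ℓ₂} (R : CommutativeRing ℓ₁ ℓ₂) where
  open CommutativeRing R renaming (_*_ to _·_; _+_ to _⊞_; refl to ≈-refl)
  open SetoidReasoning setoid
  open NatSolver commutativeSemiring using (solve; _:*_; _:=_; con)

  *-cancelʳ-invertible : ∀ {x y h h⁻¹} → h · h⁻¹ ≈ 1# → x · h ≈ y · h → x ≈ y
  *-cancelʳ-invertible {x} {y} {h} {h⁻¹} hh⁻¹≈1 xh≈yh = begin
    x                ≈⟨ *-identityʳ x ⟨
    x · 1#           ≈⟨ *-congˡ hh⁻¹≈1 ⟨
    x · (h · h⁻¹)    ≈⟨ *-assoc x h h⁻¹ ⟨
    x · h · h⁻¹      ≈⟨ *-congʳ xh≈yh ⟩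
    y · h · h⁻¹      ≈⟨ *-assoc y h h⁻¹ ⟩
    y · (h · h⁻¹)    ≈⟨ *-congˡ hh⁻¹≈1 ⟩
    y · 1#           ≈⟨ *-identityʳ y ⟩
    y                ∎

  -- Squaring Gauss's identity gives f₁⁴ = f₂²θ². The nested products ending in `1#` are the shape
  -- to which `_^^_` unfolds.
  quotient-numerator : ∀ {f₁ f₂ f₄ θ y} → f₁ · f₁ ≈ f₂ · θ → y · f₄ ≈ θ · θ →
                       f₁ · (f₁ · (f₁ · (f₁ · 1#))) ≈ y · (f₂ · (f₂ · 1#) · f₄)
  quotient-numerator {f₁} {f₂} {f₄} {θ} {y} f₁²≈f₂θ yf₄≈θ² = begin
    f₁ · (f₁ · (f₁ · (f₁ · 1#)))
      ≈⟨ solve 1 (λ x → x :* (x :* (x :* (x :* con 1))) := (x :* x) :* (x :* x)) ≈-refl f₁ ⟩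
    (f₁ · f₁) · (f₁ · f₁)
      ≈⟨ *-cong f₁²≈f₂θ f₁²≈f₂θ ⟩
    (f₂ · θ) · (f₂ · θ)
      ≈⟨ solve 2 (λ x t → (x :* t) :* (x :* t) := (x :* x) :* (t :* t)) ≈-refl f₂ θ ⟩
    (f₂ · f₂) · (θ · θ)
      ≈⟨ *-congˡ yf₄≈θ² ⟨
    (f₂ · f₂) · (y · f₄)
      ≈⟨ solve 3 (λ x y z → (x :* x) :* (y :* z) := y :* (x :* (x :* con 1) :* z)) ≈-refl f₂ y f₄ ⟩
    y · (f₂ · (f₂ · 1#) · f₄) ∎

even⊎odd : ∀ n → ∃ λ k → n ≡ k + k ⊎ n ≡ suc (k + k)
even⊎odd zero    = 0 , inj₁ refl
even⊎odd (suc n) with even⊎odd n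
... | k , inj₁ refl = k , inj₂ refl
... | k , inj₂ refl = suc k , inj₁ (cong suc (≡.sym (ℕ.+-suc k k)))

-- (-1;q)_s / (q;q)_s
qRatio : ℕ → Series
qRatio zero    = q^ 0
qRatio (suc s) = (qRatio s ⊛ (q^ 0 ⊕ q^ s)) ⊘ (q^ 0 ⊖ q^ (suc s))

-- The theta series and the quotient modulo q^(N+1).

module Truncated (N : ℕ) where
  open CommutativeRing (truncatedRing N)
    renaming (_*_ to _·_; _+_ to _⊞_; _-_ to _⊟_; -_ to ⊟_; refl to ≈-refl; sym to ≈-sym; trans to ≈-trans)
  open Exp commutativeSemiring using (_^_; ^-congˡ; ^-assocʳ; ^-homo-*; ^-distrib-*)
  open RingProperties ring using (-‿distribˡ-*; -‿distribʳ-*; -‿involutive)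

  q : Series
  q = q^ 1

  q^≈q^ : ∀ n → q^ n ≈ q ^ n
  q^≈q^ zero    = ≈-refl
  q^≈q^ (suc n) = ≈-trans (λ k _ → q^-+ 1 n k) (*-congˡ {q} (q^≈q^ n))

  qRatio-step : ∀ s → qRatio (suc s) · (1# ⊟ q ^ suc s) ≈ qRatio s · (1# ⊞ q ^ s)
  qRatio-step s = begin
    qRatio (suc s) · (1# ⊟ q ^ suc s)     ≈⟨ *-congˡ {qRatio (suc s)} (+-congˡ {1#} (-‿cong (q^≈q^ (suc s)))) ⟨
    qRatio (suc s) ⊛ (q^ 0 ⊖ q^ (suc s))  ≈⟨ (λ k _ → ⊘-correct (qRatio s ⊛ (q^ 0 ⊕ q^ s)) _ refl k) ⟩
    qRatio s ⊛ (q^ 0 ⊕ q^ s)              ≈⟨ *-congˡ {qRatio s} (+-congˡ {1#} (q^≈q^ s)) ⟩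
    qRatio s · (1# ⊞ q ^ s)               ∎
    where open SetoidReasoning setoid

  open FiniteGauss.Ratios (truncatedRing N) q qRatio ≈-refl qRatio-step public using (θ; w; P; gauss)

  P≈partialProduct : ∀ j n → P j n ≈ partialProduct j n
  P≈partialProduct j zero    = ≈-refl
  P≈partialProduct j (suc n) =
    *-cong (+-congˡ {1#} (-‿cong (≈-sym (q^≈q^ (j * suc n))))) (P≈partialProduct j n)

  partialProduct≈f : ∀ j .{{_ : NonZero j}} → partialProduct j N ≈ f j
  partialProduct≈f j k k≤N =
    ≡.trans (cong (λ n → partialProduct j n k) (≡.sym (ℕ.m∸n+n≡m k≤N))) (f-limit j (N ∸ k) k)

  P≈f : ∀ j .{{_ : NonZero j}} → P j N ≈ f j
  P≈f j = ≈-trans (P≈partialProduct j N) (partialProduct≈f j)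

  f₁²≈f₂θ : f 1 · f 1 ≈ f 2 · θ N
  f₁²≈f₂θ = begin
    f 1 · f 1      ≈⟨ *-cong (P≈f 1) (P≈f 1) ⟨
    P 1 N · P 1 N  ≈⟨ gauss N q^N+1≈0 ⟩
    P 2 N · θ N    ≈⟨ *-congʳ {θ N} (P≈f 2) ⟩
    f 2 · θ N      ∎
    where
    open SetoidReasoning setoid
    q^N+1≈0 : q ^ suc N ≈ 0#
    q^N+1≈0 = ≈-trans (≈-sym (q^≈q^ (suc N))) λ k k≤N →
      ≡.trans (≡.sym (*-identityʳ (q^ (suc N)) k k≤N)) (q^⊛-< (q^ 0) (s≤s k≤N))

  w²-power : ∀ n k → w n ^ (k + k) ≈ q ^ (n * (k + k))
  w²-power n k = begin
    w n ^ (k + k)              ≈⟨ ^-homo-* (w n) k k ⟩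
    w n ^ k · w n ^ k          ≈⟨ ^-distrib-* (w n) (w n) k ⟨
    (w n · w n) ^ k            ≈⟨ ^-congˡ k w·w ⟩
    (q ^ n · q ^ n) ^ k        ≈⟨ ^-distrib-* (q ^ n) (q ^ n) k ⟩
    (q ^ n) ^ k · (q ^ n) ^ k ≈⟨ ^-homo-* (q ^ n) k k ⟨
    (q ^ n) ^ (k + k)          ≈⟨ ^-assocʳ q n (k + k) ⟩
    q ^ (n * (k + k))          ∎
    where
    open SetoidReasoning setoid
    w·w : w n · w n ≈ q ^ n · q ^ n
    w·w = begin
      ⊟ q ^ n · ⊟ q ^ n      ≈⟨ -‿distribˡ-* (q ^ n) (⊟ (q ^ n)) ⟨
      ⊟ (q ^ n · ⊟ q ^ n)    ≈⟨ -‿cong (-‿distribʳ-* (q ^ n) (q ^ n)) ⟨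
      ⊟ (⊟ (q ^ n · q ^ n))  ≈⟨ -‿involutive (q ^ n · q ^ n) ⟩
      q ^ n · q ^ n          ∎

  -- `w n ^ n` is (-1)^n q^(n²), that is q^(4i²) for n = 2i and -q^(1+4(i²+i)) for n = 2i + 1.
  w^n-θSign : ∀ n k → k ≤ N → θSign k ((w n ^ n) k)
  w^n-θSign n k k≤N with even⊎odd n
  ... | i , inj₁ refl = subst (θSign k) (≡.sym (even k k≤N)) (q^[4t]-θSign (i * i) k)
    where
    open SetoidReasoning setoid
    even : w (i + i) ^ (i + i) ≈ q^ (i * i * 4)
    even = begin
      w (i + i) ^ (i + i)      ≈⟨ w²-power (i + i) i ⟩
      q ^ ((i + i) * (i + i))  ≈⟨ q^≈q^ ((i + i) * (i + i)) ⟨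
      q^ ((i + i) * (i + i))   ≈⟨ reflexive (cong q^ (solve 1 (λ i → (i :+ i) :* (i :+ i) := i :* i :* con 4) refl i)) ⟩
      q^ (i * i * 4)           ∎
      where open +-*-Solver
  ... | i , inj₂ refl = subst (θSign k) (≡.sym (odd k k≤N)) (-q^[1+4t]-θSign (i * i + i) k)
    where
    open SetoidReasoning setoid
    n′ = suc (i + i)
    odd : w n′ ^ n′ ≈ ⊟ q^ (1 + (i * i + i) * 4)
    odd = begin
      w n′ · w n′ ^ (i + i)                 ≈⟨ *-congˡ {w n′} (w²-power n′ i) ⟩
      ⊟ q ^ n′ · q ^ (n′ * (i + i))         ≈⟨ -‿distribˡ-* (q ^ n′) (q ^ (n′ * (i + i))) ⟨
      ⊟ (q ^ n′ · q ^ (n′ * (i + i)))       ≈⟨ -‿cong (^-homo-* q n′ (n′ * (i + i))) ⟨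
      ⊟ q ^ (n′ + n′ * (i + i))             ≈⟨ -‿cong (q^≈q^ (n′ + n′ * (i + i))) ⟨
      ⊟ q^ (n′ + n′ * (i + i))              ≈⟨ -‿cong (reflexive (cong q^ (solve 1 (λ i →
                                                 (con 1 :+ (i :+ i)) :+ (con 1 :+ (i :+ i)) :* (i :+ i)
                                                 := con 1 :+ (i :* i :+ i) :* con 4) refl i))) ⟩
      ⊟ q^ (1 + (i * i + i) * 4)            ∎
      where open +-*-Solver

  -- With the factor 2 written as a repeated summand, closure of `θSign` under addition suffices.
  θ-suc : ∀ n → θ (suc n) ≈ θ n ⊞ (w (suc n) ^ suc n ⊞ w (suc n) ^ suc n)
  θ-suc n = +-congˡ {θ n} (≈-trans (distribʳ W 1# 1#) (+-cong (*-identityˡ W) (*-identityˡ W)))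
    where W = w (suc n) ^ suc n

  θ-θSign : ∀ n k → k ≤ N → θSign k (θ n k)
  θ-θSign zero    k k≤N = q^[4t]-θSign 0 k
  θ-θSign (suc n) k k≤N = subst (θSign k) (≡.sym (θ-suc n k k≤N))
    (θSign-+ k (θ-θSign n k k≤N)
      (θSign-+ k (w^n-θSign (suc n) k k≤N) (w^n-θSign (suc n) k k≤N)))

  θ²-WeakSign : ∀ k → k ≤ N → WeakSign k ((θ N ⊛ θ N) k)
  θ²-WeakSign k k≤N = ⊛-WeakSign k signs signs
    where
    signs : ∀ i → i ≤ k → θSign i (θ N i)
    signs i i≤k = θ-θSign N i (ℕ.≤-trans i≤k k≤N)

  θ[1+n]₀ : ∀ n → θ (suc n) 0 ≡ 1ℤ
  θ[1+n]₀ zero    = refl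
  θ[1+n]₀ (suc n) = ≡.trans (θ-suc (suc n) 0 z≤n) (≡.trans (ℤ.+-identityʳ _) (θ[1+n]₀ n))

  -- The term -2q enters with `θ 1`, hence the index `suc n`. The truncated ring sees the
  -- coefficient of q only for 1 ≤ N.
  θ[1+n]₁ : 1 ≤ N → ∀ n → θ (suc n) 1 ≡ ℤ.-[1+ 1 ]
  θ[1+n]₁ 1≤N zero    = refl
  θ[1+n]₁ 1≤N (suc n) = ≡.trans (θ-suc (suc n) 1 1≤N)
    (≡.trans (cong (λ x → θ (suc n) 1 ℤ.+ (x ℤ.+ x)) W₁≡0) (≡.trans (ℤ.+-identityʳ _) (θ[1+n]₁ 1≤N n)))
    where
    W = w (2 + n) ^ (2 + n)
    W₁≡0 : W 1 ≡ 0ℤ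
    -- `W` is a product of two series without constant term, so it starts at q² or later.
    W₁≡0 = ≡.trans (ℤ.+-identityˡ _) (≡.trans (ℤ.+-identityʳ _) (ℤ.*-zeroʳ (w (2 + n) 1)))

  -- θ² / ((1 - q⁴)(1 - q⁸) ⋯ (1 - q⁴ⁿ))
  quotient : ℕ → Series
  quotient zero    = θ N ⊛ θ N
  quotient (suc n) = quotient n ⊘ (q^ 0 ⊖ q^ (suc n * 4))

  quotient-correct : ∀ n → quotient n · partialProduct 4 n ≈ θ N · θ N
  quotient-correct zero    = *-identityʳ (θ N · θ N)
  quotient-correct (suc n) = begin
    quotient (suc n) · ((q^ 0 ⊖ q^ (4 * suc n)) · partialProduct 4 n)
      ≈⟨ *-assoc (quotient (suc n)) (q^ 0 ⊖ q^ (4 * suc n)) (partialProduct 4 n) ⟨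
    quotient (suc n) · (q^ 0 ⊖ q^ (4 * suc n)) · partialProduct 4 n
      ≡⟨ cong (λ m → quotient (suc n) · (q^ 0 ⊖ q^ m) · partialProduct 4 n) (ℕ.*-comm 4 (suc n)) ⟩
    quotient (suc n) · (q^ 0 ⊖ q^ (suc n * 4)) · partialProduct 4 n
      ≈⟨ *-congʳ {partialProduct 4 n} (λ k _ → ⊘-correct (quotient n) (q^ 0 ⊖ q^ (suc n * 4)) refl k) ⟩
    quotient n · partialProduct 4 n
      ≈⟨ quotient-correct n ⟩
    θ N · θ N ∎
    where open SetoidReasoning setoid

  -- Multiplied by `D`, both sides give f₁⁴. As `D` has constant term 1, it has the inverse
  -- `q^ 0 ⊘ D` and can be cancelled.
  a≈quotient : a ≈ quotient N
  a≈quotient = *-cancelʳ-invertible (truncatedRing N) {a} {quotient N} {D} {q^ 0 ⊘ D}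
    (≈-trans (*-comm D (q^ 0 ⊘ D)) (λ k _ → ⊘-correct (q^ 0) D refl k))
    (≈-trans (λ k _ → a-correct k)
      (quotient-numerator (truncatedRing N) {f 1} {f 2} {f 4} {θ N} {quotient N} f₁²≈f₂θ
        (≈-trans (*-congˡ {quotient N} (≈-sym (partialProduct≈f 4))) (quotient-correct N))))
    where
    D : Series
    D = f 2 ^^ 2 ⊛ f 4

-- Strict signs of the coefficients.

-- The square of 1 - 2q + 0q² + ⋯ begins 1 - 4q + 4q². The values of `F 1` and `F 2` are demanded
-- only up to exponent `n`, since the truncation may end before them.
square-StrictSign : ∀ F n → n ℕ.< 3 → F 0 ≡ 1ℤ → (1 ≤ n → F 1 ≡ ℤ.-[1+ 1 ]) → (2 ≤ n → F 2 ≡ 0ℤ) →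
                    StrictSign n ((F ⊛ F) n)
square-StrictSign F 0 _ F₀ _ _ rewrite F₀ = ℤ.+<+ (s≤s z≤n)
square-StrictSign F 1 _ F₀ F₁ _ rewrite F₀ | F₁ (s≤s z≤n) = ℤ.-<+
square-StrictSign F 2 _ F₀ F₁ F₂ rewrite F₀ | F₁ (s≤s z≤n) | F₂ (s≤s (s≤s z≤n)) = ℤ.+<+ (s≤s z≤n)
square-StrictSign F (suc (suc (suc n))) (s≤s (s≤s (s≤s ())))

-- The induction starts after the division by 1 - q⁴, since θ² itself is only weakly signed: that
-- division spreads the strict signs at exponents below 4 to all exponents. The later divisions
-- preserve them.
quotient-StrictSign : ∀ N n k → k ≤ suc N → StrictSign k (Truncated.quotient (suc N) (suc n) k)
quotient-StrictSign N zero = ⊘-factor-StrictSign 0 (θ N′ ⊛ θ N′) low θ²-WeakSign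
  where
  N′ = suc N
  open Truncated N′
  low : ∀ k → k ℕ.< 4 → k ≤ N′ → StrictSign k ((θ N′ ⊛ θ N′) k)
  low k k<4 k≤N′ with ℕ.m≤n⇒m<n∨m≡n (ℕ.≤-pred k<4)
  ... | inj₁ k<3  = square-StrictSign (θ N′) k k<3 (θ[1+n]₀ N) (λ _ → θ[1+n]₁ (s≤s z≤n) N)
                      (λ 2≤k → θ-θSign N′ 2 (ℕ.≤-trans 2≤k k≤N′))
  -- At exponent 3 the weak and the strict pattern agree.
  ... | inj₂ refl = θ²-WeakSign 3 k≤N′
quotient-StrictSign N (suc n) = ⊘-factor-StrictSign (suc n) (Truncated.quotient (suc N) (suc n))
  (λ k _ → quotient-StrictSign N n k)
  (λ k k≤N → StrictSign⇒WeakSign k (quotient-StrictSign N n k k≤N))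

a-StrictSign : ∀ n → StrictSign n (a n)
-- Truncation at order `suc n` instead of `n` keeps the order positive for n = 0.
a-StrictSign n = subst (StrictSign n) (≡.sym (a≈quotient n (ℕ.n≤1+n n)))
  (quotient-StrictSign n n n (ℕ.n≤1+n n))
  where open Truncated (suc n)

StrictSign-2n : ∀ n {x} → StrictSign (n * 2) x → x > 0ℤ
StrictSign-2n 0 0<x = 0<x
StrictSign-2n 1 0<x = 0<x
StrictSign-2n (suc (suc n)) = StrictSign-2n n

StrictSign-4n : ∀ n r {x} → StrictSign (4 * n + r) x → StrictSign r x
StrictSign-4n n r {x} s = subst (λ S → S) (StrictSign-mod4 n r)
  (subst (λ m → StrictSign (m + r) x) (ℕ.*-comm 4 n) s)

theorem4p10 : (n : ℕ) →
    (a (2 * n) > 0ℤ) ×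
    (a (4 * n + 1) < 0ℤ) ×
    (a (4 * n + 3) ≡ 0ℤ)
theorem4p10 n =
  StrictSign-2n n (subst (λ m → StrictSign m (a (2 * n))) (ℕ.*-comm 2 n) (a-StrictSign (2 * n))) ,
  StrictSign-4n n 1 (a-StrictSign (4 * n + 1)) ,
  StrictSign-4n n 3 (a-StrictSign (4 * n + 3))
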